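{- For every integer $n\geq 2$, the $n$-book graph satisfies $\chi_{D_L}(B_n)=\chi_D(B_n)$.
   Context: The $n$-book graph $B_n$ ($n\geq 2$) is the Cartesian product of the star $K_{1,n}$ and the path $P_2$ on two vertices; concretely it has vertices $v_0,w_0,v_1,w_1,\dots,v_n,w_n$ and edges $v_0w_0$, $v_0v_i$, $w_0w_i$, $v_iw_i$ for $1\leq i\leq n$. A vertex coloring is distinguishing if the only automorphism preserving all vertex colors is the identity. The distinguishing chromatic number $\chi_D(G)$ is the minimum $r$ such that $G$ has a proper distinguishing coloring with $r$ colors. Given a list assignment $L$ (a finite set $L(v)$ of colors for each vertex), $G$ is properly $L$-distinguishable if there is a proper distinguishing coloring $f$ with $f(v)\in L(v)$ for all $v$; $\chi_{D_L}(G)$ is the minimum $k$ such that $G$ is properly $L$-distinguishable for every list assignment with $|L(v)|=k$ for all $v$. -}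

module Defs where

open import Level using (0ℓ)
open import Data.Nat using (ℕ; zero; suc; _<_)
open import Data.Fin using (Fin)
open import Data.Bool using (Bool; true; false)
open import Data.Product using (Σ; _×_; _,_; proj₁)
open import Data.List using (List; length)
open import Data.List.Membership.Propositional using (_∈_)
open import Data.List.Relation.Unary.Unique.Propositional using (Unique)
open import Relation.Binary.PropositionalEquality using (_≡_; _≢_)
open import Relation.Nullary using (¬_)

record Automorphism {V : Set} (Adj : V → V → Set) : Set where
  field
    to      : V → V
    from    : V → V
    to-from : ∀ v → to (from v) ≡ v
    from-to : ∀ v → from (to v) ≡ v
    adj→    : ∀ u v → Adj u v → Adj (to u) (to v)
    adj←    : ∀ u v → Adj (to u) (to v) → Adj u v

open Automorphism public

Proper : {V C : Set} (Adj : V → V → Set) → (V → C) → Set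
Proper Adj f = ∀ u v → Adj u v → f u ≢ f v

Distinguishing : {V C : Set} (Adj : V → V → Set) → (V → C) → Set
Distinguishing Adj f =
  (σ : Automorphism Adj) → (∀ v → f (to σ v) ≡ f v) → ∀ v → to σ v ≡ v

ProperDistR : {V : Set} (Adj : V → V → Set) → ℕ → Set
ProperDistR {V} Adj r =
  Σ (V → Fin r) (λ f → Proper Adj f × Distinguishing Adj f)

ListAssignment : Set → ℕ → Set
ListAssignment V k = Σ (V → List ℕ) (λ L → ∀ v → Unique (L v) × length (L v) ≡ k)

LDistinguishable : {V : Set} (Adj : V → V → Set) → (V → List ℕ) → Set
LDistinguishable {V} Adj L =
  Σ (V → ℕ) (λ f → (∀ v → f v ∈ L v) × Proper Adj f × Distinguishing Adj f)

ProperDistListK : {V : Set} (Adj : V → V → Set) → ℕ → Set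
ProperDistListK {V} Adj k =
  (L : ListAssignment V k) → LDistinguishable Adj (proj₁ L)

IsMinimum : (ℕ → Set) → ℕ → Set
IsMinimum P m = P m × (∀ k → k < m → ¬ P k)

χD≡ : {V : Set} (Adj : V → V → Set) → ℕ → Set
χD≡ Adj m = IsMinimum (ProperDistR Adj) m

χDL≡ : {V : Set} (Adj : V → V → Set) → ℕ → Set
χDL≡ Adj m = IsMinimum (ProperDistListK Adj) m

-- The n-book graph B_n = K_{1,n} □ P_2.
-- Vertices: (false , i) is v_i and (true , i) is w_i, for i ∈ Fin (suc n)
-- (index 0 is the spine vertex v_0 / w_0).

BookV : ℕ → Set
BookV n = Bool × Fin (suc n)

data BookAdj (n : ℕ) : BookV n → BookV n → Set where
  spine  : BookAdj n (false , Fin.zero) (true , Fin.zero)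
  spine' : BookAdj n (true , Fin.zero) (false , Fin.zero)
  hub    : ∀ b (i : Fin n) → BookAdj n (b , Fin.zero) (b , Fin.suc i)
  hub'   : ∀ b (i : Fin n) → BookAdj n (b , Fin.suc i) (b , Fin.zero)
  rung   : ∀ (i : Fin n) → BookAdj n (false , Fin.suc i) (true , Fin.suc i)
  rung'  : ∀ (i : Fin n) → BookAdj n (true , Fin.suc i) (false , Fin.suc i)

{-# OPTIONS --safe #-}

-- A proper coloring of B_n gives the two hubs different colors a ≠ b, so an
-- automorphism preserving it fixes both hubs and permutes the pages; hence the
-- coloring is distinguishing iff the n pages carry distinct pairs (x , y), with
-- x ≠ a, y ≠ b, x ≠ y.  With k + 2 colors there are (k + 1)k + 1 such pairs,
-- so χ_D is k + 2 for the least k with n ≤ (k + 1)k + 1.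
--
-- From lists of size k + 2 every page has at least (k + 1)k admissible pairs,
-- whatever the hub colors are.  Choosing the hub colors with one page in mind,
-- that page has one pair more, so coloring the pages greedily with this page
-- last succeeds.

module Submission where

open import Defs
open import Data.Nat using (ℕ; zero; suc; _+_; _*_; _≤_; _<_; z≤n; s≤s; s≤s⁻¹; >-nonZero)
open import Data.Nat.Properties
open import Data.Nat.Induction using (<-rec)
open import Data.Bool using (Bool; true; false)
open import Data.Empty using (⊥; ⊥-elim)
open import Data.Fin as Fin using (Fin; toℕ)
import Data.Fin.Properties as Fin
open import Data.Fin.Permutation.Components using (transpose; transpose-inverse)
open import Data.Product using (∃; ∃₂; _×_; _,_; proj₁; proj₂)
open import Data.Product.Properties using (≡-dec; ,-injectiveˡ; ,-injectiveʳ)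
open import Data.Sum using (_⊎_; inj₁; inj₂; [_,_]′)
open import Data.List using (List; []; _∷_; _++_; length; map; filter; tabulate; allFin; cartesianProduct)
open import Data.List.Properties using (length-++; length-map; length-tabulate; filter-notAll)
open import Data.List.Membership.Propositional using (_∈_; _∉_; lose)
open import Data.List.Membership.Propositional.Properties
open import Data.List.Relation.Binary.Subset.Propositional using (_⊆_)
import Data.List.Relation.Unary.All as All
open import Data.List.Relation.Unary.Any using (here; there; any?)
open import Data.List.Relation.Unary.Unique.Propositional using (Unique)
import Data.List.Relation.Unary.Unique.Propositional.Properties as Unique
open import Data.List.Relation.Unary.AllPairs using ([]; _∷_)
open import Function using (_∘_; id)
open import Function.Definitions using (Injective)
open import Relation.Binary.Definitions using (DecidableEquality)
open import Relation.Binary.PropositionalEquality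
  using (_≡_; _≢_; refl; sym; trans; cong; cong₂; subst; subst₂)
open import Relation.Nullary using (¬_; ¬?; Dec; yes; no; contradiction)
open import Relation.Unary using (Decidable)

-- Product lengths and least witnesses

length-cartesianProduct : {A B : Set} (xs : List A) (ys : List B) →
  length (cartesianProduct xs ys) ≡ length xs * length ys
length-cartesianProduct []       ys = refl
length-cartesianProduct (x ∷ xs) ys =
  trans (length-++ (map (x ,_) ys))
        (cong₂ _+_ (length-map (x ,_) ys) (length-cartesianProduct xs ys))

-- By strong induction: a bounded search either finds a smaller witness to recurse on or certifies
-- that `m` is minimal.
least : {P : ℕ → Set} → Decidable P → ∀ m → P m → ∃ (IsMinimum P)
least {P} P? = <-rec (λ m → P m → ∃ (IsMinimum P)) step
  where
  step : ∀ m → (∀ {j} → j < m → P j → ∃ (IsMinimum P)) → P m → ∃ (IsMinimum P)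
  step m rec Pm with anyUpTo? P? m
  ... | yes (j , j<m , Pj) = rec j<m Pj
  ... | no  none           = m , Pm , λ j j<m Pj → none (j , j<m , Pj)

-- Counting in lists without repetition

module Counting {A : Set} (_≟_ : DecidableEquality A) where

  infixl 6 _∖_

  _∖_ : List A → A → List A
  xs ∖ a = filter (λ x → ¬? (x ≟ a)) xs

  ∈-∖⁺ : ∀ {a x xs} → x ∈ xs → x ≢ a → x ∈ xs ∖ a
  ∈-∖⁺ = ∈-filter⁺ (λ x → ¬? (x ≟ _))

  ∈-∖⁻ : ∀ {a x} xs → x ∈ xs ∖ a → x ∈ xs × x ≢ a
  ∈-∖⁻ xs = ∈-filter⁻ (λ x → ¬? (x ≟ _)) {xs = xs}

  ∖-unique : ∀ {a xs} → Unique xs → Unique (xs ∖ a)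
  ∖-unique = Unique.filter⁺ (λ x → ¬? (x ≟ _))

  length-∖-< : ∀ {a xs} → a ∈ xs → length (xs ∖ a) < length xs
  length-∖-< {a} {xs} a∈xs =
    filter-notAll (λ x → ¬? (x ≟ a)) xs (lose a∈xs (λ a≢a → a≢a refl))

  -- Pigeonhole, by induction on `xs`: uniqueness keeps the tail clear of the head, so the tail
  -- still lies in `ys` with the head removed, which is strictly shorter.
  length-⊆ : ∀ {xs ys} → Unique xs → xs ⊆ ys → length xs ≤ length ys
  length-⊆ []            _     = z≤n
  length-⊆ (x∉xs ∷ uniq) xs⊆ys = ≤-trans
    (s≤s (length-⊆ uniq λ z∈xs →
      ∈-∖⁺ (xs⊆ys (there z∈xs)) λ z≡x → All.lookup x∉xs z∈xs (sym z≡x)))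
    (length-∖-< (xs⊆ys (here refl)))

  length-∖-≥ : ∀ {xs} a → Unique xs → length xs ≤ suc (length (xs ∖ a))
  length-∖-≥ {xs} a uniq = length-⊆ {ys = a ∷ xs ∖ a} uniq cover
    where
    cover : xs ⊆ a ∷ xs ∖ a
    cover {z} z∈xs with z ≟ a
    ... | yes z≡a = here z≡a
    ... | no  z≢a = there (∈-∖⁺ z∈xs z≢a)

  length-∖-∉ : ∀ {a xs} → Unique xs → a ∉ xs → length xs ≤ length (xs ∖ a)
  length-∖-∉ {a} {xs} uniq a∉xs =
    length-⊆ uniq λ z∈xs → ∈-∖⁺ z∈xs λ z≡a → a∉xs (subst (_∈ xs) z≡a z∈xs)

  _∈?_ : ∀ x xs → Dec (x ∈ xs)
  x ∈? xs = any? (x ≟_) xs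

  ⊆-or-∃∉ : ∀ xs ys → xs ⊆ ys ⊎ ∃ λ x → x ∈ xs × x ∉ ys
  ⊆-or-∃∉ []       ys = inj₁ λ ()
  ⊆-or-∃∉ (x ∷ xs) ys with x ∈? ys | ⊆-or-∃∉ xs ys
  ... | no  x∉ys | _                       = inj₂ (x , here refl , x∉ys)
  ... | yes _    | inj₂ (z , z∈xs , z∉ys)  = inj₂ (z , there z∈xs , z∉ys)
  ... | yes x∈ys | inj₁ xs⊆ys              = inj₁ λ { (here refl) → x∈ys ; (there z∈xs) → xs⊆ys z∈xs }

  fresh : ∀ {xs} ys → Unique xs → length ys < length xs → ∃ λ x → x ∈ xs × x ∉ ys
  fresh {xs} ys uniq ys<xs with ⊆-or-∃∉ xs ys
  ... | inj₁ xs⊆ys = contradiction (length-⊆ uniq xs⊆ys) (<⇒≱ ys<xs)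
  ... | inj₂ found = found

  -- The greedy algorithm, with index 0 served last.
  greedy : ∀ m (C : Fin m → List A) → (∀ i → Unique (C i)) →
    (∀ i → m ≤ length (C i) + toℕ i) →
    ∃ λ (g : Fin m → A) → (∀ i → g i ∈ C i) × Injective _≡_ _≡_ g
  greedy zero    C uniq large = (λ ()) , (λ ()) , λ {i} → ⊥-elim (Fin.¬Fin0 i)
  greedy (suc m) C uniq large
    -- Index `i` is served after the higher indices only, so it can afford a list shorter by
    -- `toℕ i`. Dropping index 0 lowers the number of indices and each remaining `toℕ` by one, so
    -- the size hypothesis persists.
    with greedy m (C ∘ Fin.suc) (uniq ∘ Fin.suc)
           (λ i → s≤s⁻¹ (subst (suc m ≤_) (+-suc _ _) (large (Fin.suc i))))
  ... | g , g∈C , g-inj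
    with fresh (tabulate g) (uniq Fin.zero)
           (subst₂ _<_ (sym (length-tabulate g)) (+-identityʳ _) (large Fin.zero))
  ... | x , x∈C₀ , x∉g = h , h∈C , h-inj
    where
    h : Fin (suc m) → A
    h Fin.zero    = x
    h (Fin.suc i) = g i

    h∈C : ∀ i → h i ∈ C i
    h∈C Fin.zero    = x∈C₀
    h∈C (Fin.suc i) = g∈C i

    h-inj : Injective _≡_ _≡_ h
    h-inj {Fin.zero}  {Fin.zero}  _  = refl
    h-inj {Fin.zero}  {Fin.suc j} eq = contradiction (subst (_∈ tabulate g) (sym eq) (∈-tabulate⁺ j)) x∉g
    h-inj {Fin.suc i} {Fin.zero}  eq = contradiction (subst (_∈ tabulate g) eq (∈-tabulate⁺ i)) x∉g
    h-inj {Fin.suc i} {Fin.suc j} eq = cong Fin.suc (g-inj eq)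

-- Pairs of distinct elements

module OffDiagonal {A : Set} (_≟_ : DecidableEquality A) where

  open Counting _≟_
  private module Pairs = Counting (≡-dec _≟_ _≟_)

  diagonal : List A → List (A × A)
  diagonal = map (λ x → x , x)

  offDiagonal : List A → List A → List (A × A)
  offDiagonal xs ys = filter (λ p → ¬? (proj₁ p ≟ proj₂ p)) (cartesianProduct xs ys)

  offDiagonal-unique : ∀ {xs ys} → Unique xs → Unique ys → Unique (offDiagonal xs ys)
  offDiagonal-unique uxs uys =
    Unique.filter⁺ (λ p → ¬? (proj₁ p ≟ proj₂ p)) (Unique.cartesianProduct⁺ uxs uys)

  ∈-offDiagonal⁻ : ∀ {p} xs ys → p ∈ offDiagonal xs ys →
    proj₁ p ∈ xs × proj₂ p ∈ ys × proj₁ p ≢ proj₂ p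
  ∈-offDiagonal⁻ xs ys p∈
    with p∈× , x≢y ← ∈-filter⁻ (λ p → ¬? (proj₁ p ≟ proj₂ p)) {xs = cartesianProduct xs ys} p∈
    with x∈xs , y∈ys ← ∈-cartesianProduct⁻ xs ys p∈× = x∈xs , y∈ys , x≢y

  private
    -- A pair of the product is off-diagonal or is `(x , x)` with `x` common to both lists. Keeping
    -- the cover `zs` of the common elements as a parameter serves both bounds below.
    count : ∀ {xs ys} zs → Unique xs → Unique ys → (∀ {x} → x ∈ xs → x ∈ ys → x ∈ zs) →
      length xs * length ys ≤ length (offDiagonal xs ys) + length zs
    count {xs} {ys} zs uxs uys common = begin
      length xs * length ys                                ≡⟨ length-cartesianProduct xs ys ⟨
      length (cartesianProduct xs ys)                      ≤⟨ Pairs.length-⊆ (Unique.cartesianProduct⁺ uxs uys) cover ⟩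
      length (offDiagonal xs ys ++ diagonal zs)            ≡⟨ length-++ (offDiagonal xs ys) ⟩
      length (offDiagonal xs ys) + length (diagonal zs)    ≡⟨ cong (length (offDiagonal xs ys) +_) (length-map _ zs) ⟩
      length (offDiagonal xs ys) + length zs               ∎
      where
      open ≤-Reasoning
      cover : cartesianProduct xs ys ⊆ offDiagonal xs ys ++ diagonal zs
      cover {x , y} p∈ with x ≟ y
      ... | no  x≢y  = ∈-++⁺ˡ (∈-filter⁺ (λ p → ¬? (proj₁ p ≟ proj₂ p)) p∈ x≢y)
      ... | yes refl with x∈xs , x∈ys ← ∈-cartesianProduct⁻ xs ys p∈ =
        ∈-++⁺ʳ (offDiagonal xs ys) (∈-map⁺ _ (common x∈xs x∈ys))

    -- Taking `m` from `m * n` leaves `m` times the predecessor of `n`, and that predecessor is at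
    -- least `q`.
    cancel : ∀ {p q m n c} → p ≤ m → suc q ≤ n → m * n ≤ c + m → p * q ≤ c
    cancel {p} {q} {m} {n} {c} p≤m q<n mn≤c+m = +-cancelʳ-≤ m (p * q) c (begin
      p * q + m   ≤⟨ +-monoˡ-≤ m (*-monoˡ-≤ q p≤m) ⟩
      m * q + m   ≡⟨ +-comm (m * q) m ⟩
      m + m * q   ≡⟨ *-suc m q ⟨
      m * suc q   ≤⟨ *-monoʳ-≤ m q<n ⟩
      m * n       ≤⟨ mn≤c+m ⟩
      c + m       ∎)
      where open ≤-Reasoning

  length-offDiagonal : ∀ {p q xs ys} → Unique xs → Unique ys →
    p ≤ length xs → suc q ≤ length ys → p * q ≤ length (offDiagonal xs ys)
  length-offDiagonal {xs = xs} uxs uys p≤ q< = cancel p≤ q< (count xs uxs uys λ x∈xs _ → x∈xs)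

  -- The element `x` yields no diagonal pair, so `xs` without `x` covers the common elements, and
  -- one pair fewer is subtracted.
  length-offDiagonal-< : ∀ {p q x xs ys} → Unique xs → Unique ys →
    p ≤ length xs → suc q ≤ length ys → x ∈ xs → x ∉ ys →
    p * q < length (offDiagonal xs ys)
  length-offDiagonal-< {p} {q} {x} {xs} {ys} uxs uys p≤ q< x∈xs x∉ys =
    strict (length-∖-< x∈xs)
      (count (xs ∖ x) uxs uys λ {z} z∈xs z∈ys → ∈-∖⁺ z∈xs λ z≡x → x∉ys (subst (_∈ ys) z≡x z∈ys))
    where
    strict : ∀ {d} → d < length xs → length xs * length ys ≤ length (offDiagonal xs ys) + d →
             p * q < length (offDiagonal xs ys)
    strict {d} d<m mn≤c+d with length (offDiagonal xs ys)
    -- With no off-diagonal pair the whole product would have length at most `d`, yet `ys` is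
    -- nonempty and `d < length xs`.
    ... | zero  = contradiction (≤-trans (m≤m*n (length xs) (length ys) ⦃ >-nonZero (≤-trans (s≤s z≤n) q<) ⦄) mn≤c+d) (<⇒≱ d<m)
    -- One off-diagonal pair is traded for the deficit of `d`: `suc c + d` is at most
    -- `c + length xs`.
    ... | suc c = s≤s (cancel p≤ q< (≤-trans mn≤c+d (subst (_≤ c + length xs) (+-suc c d) (+-monoʳ-≤ c d<m))))

-- Automorphisms of the book

BookAdj-sym : ∀ {n u v} → BookAdj n u v → BookAdj n v u
BookAdj-sym spine      = spine'
BookAdj-sym spine'     = spine
BookAdj-sym (hub b i)  = hub' b i
BookAdj-sym (hub' b i) = hub b i
BookAdj-sym (rung i)   = rung' i
BookAdj-sym (rung' i)  = rung i

to-injective : {V : Set} {Adj : V → V → Set} (σ : Automorphism Adj) → ∀ {u v} → to σ u ≡ to σ v → u ≡ v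
to-injective σ eq = trans (sym (from-to σ _)) (trans (cong (from σ) eq) (from-to σ _))

module _ {n : ℕ} where

  onPages : (Fin n → Fin n) → BookV n → BookV n
  onPages π (b , Fin.zero)  = b , Fin.zero
  onPages π (b , Fin.suc i) = b , Fin.suc (π i)

  onPages-adj : ∀ π u v → BookAdj n u v → BookAdj n (onPages π u) (onPages π v)
  onPages-adj π _ _ spine      = spine
  onPages-adj π _ _ spine'     = spine'
  onPages-adj π _ _ (hub b i)  = hub b (π i)
  onPages-adj π _ _ (hub' b i) = hub' b (π i)
  onPages-adj π _ _ (rung i)   = rung (π i)
  onPages-adj π _ _ (rung' i)  = rung' (π i)

  onPages-inverse : ∀ {π ρ} → (∀ i → π (ρ i) ≡ i) → ∀ v → onPages π (onPages ρ v) ≡ v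
  onPages-inverse πρ (b , Fin.zero)  = refl
  onPages-inverse πρ (b , Fin.suc i) = cong (λ j → b , Fin.suc j) (πρ i)

  swapPages : Fin n → Fin n → Automorphism (BookAdj n)
  swapPages i j = record
    { to      = onPages (transpose i j)
    ; from    = onPages (transpose j i)
    ; to-from = ij∘ji
    ; from-to = ji∘ij
    ; adj→    = onPages-adj (transpose i j)
    ; adj←    = λ u v adj →
        subst₂ (BookAdj n) (ji∘ij u) (ji∘ij v) (onPages-adj (transpose j i) _ _ adj)
    }
    where
    ij∘ji : ∀ v → onPages (transpose i j) (onPages (transpose j i) v) ≡ v
    ij∘ji = onPages-inverse (λ _ → transpose-inverse i j)
    ji∘ij : ∀ v → onPages (transpose j i) (onPages (transpose i j) v) ≡ v
    ji∘ij = onPages-inverse (λ _ → transpose-inverse j i)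

  transpose-≡ : {C : Set} (f : Fin n → C) → ∀ i j → f i ≡ f j → ∀ k → f (transpose i j k) ≡ f k
  transpose-≡ f i j fi≡fj k with k Fin.≟ i
  ... | yes refl = sym fi≡fj
  ... | no  _ with k Fin.≟ j
  ...   | yes refl = fi≡fj
  ...   | no  _    = refl

  transpose-first : ∀ i j → transpose {n} i j i ≡ j
  transpose-first i j with i Fin.≟ i
  ... | yes _   = refl
  ... | no  i≢i = contradiction refl i≢i

  -- Distinguishing colorings in terms of page colors

  pageColors : {C : Set} → (BookV n → C) → Fin n → C × C
  pageColors f i = f (false , Fin.suc i) , f (true , Fin.suc i)

  -- Exchanging two pages with equal color pairs preserves every color, so the exchange must be the
  -- identity.
  distinguishing⇒injective : {C : Set} (f : BookV n → C) →
    Distinguishing (BookAdj n) f → Injective _≡_ _≡_ (pageColors f)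
  distinguishing⇒injective f dist {i} {j} eq = sym (trans (sym (transpose-first i j))
    (Fin.suc-injective (,-injectiveʳ (dist (swapPages i j) preserved (false , Fin.suc i)))))
    where
    eqs : ∀ b → f (b , Fin.suc i) ≡ f (b , Fin.suc j)
    eqs false = ,-injectiveˡ eq
    eqs true  = ,-injectiveʳ eq
    preserved : ∀ v → f (onPages (transpose i j) v) ≡ f v
    preserved (b , Fin.zero)  = refl
    preserved (b , Fin.suc k) = transpose-≡ (λ k → f (b , Fin.suc k)) i j (eqs b) k

  -- A page vertex has degree two: its hub and the other end of its rung. The form with three
  -- neighbours is what refutes three distinct ones.
  page-degree : ∀ {b i x y z} → BookAdj n (b , Fin.suc i) x → BookAdj n (b , Fin.suc i) y →
    BookAdj n (b , Fin.suc i) z → x ≡ y ⊎ y ≡ z ⊎ x ≡ z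
  page-degree (hub' _ _) (hub' _ _) _          = inj₁ refl
  page-degree (rung _)   (rung _)   _          = inj₁ refl
  page-degree (rung' _)  (rung' _)  _          = inj₁ refl
  page-degree _          (hub' _ _) (hub' _ _) = inj₂ (inj₁ refl)
  page-degree _          (rung _)   (rung _)   = inj₂ (inj₁ refl)
  page-degree _          (rung' _)  (rung' _)  = inj₂ (inj₁ refl)
  page-degree (hub' _ _) _          (hub' _ _) = inj₂ (inj₂ refl)
  page-degree (rung _)   _          (rung _)   = inj₂ (inj₂ refl)
  page-degree (rung' _)  _          (rung' _)  = inj₂ (inj₂ refl)

  page≢hub : ∀ {b b′ i} → _≢_ {A = BookV n} (b , Fin.suc i) (b′ , Fin.zero)
  page≢hub ()

  hub-neighbour : ∀ {b v} → BookAdj n (b , Fin.zero) v →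
    (∃ λ b′ → v ≡ (b′ , Fin.zero)) ⊎ (∃ λ i → v ≡ (b , Fin.suc i))
  hub-neighbour spine     = inj₁ (_ , refl)
  hub-neighbour spine'    = inj₁ (_ , refl)
  hub-neighbour (hub _ i) = inj₂ (i , refl)

  module _ (2≤n : 2 ≤ n) where

    private
      page₁ page₂ : Fin n
      page₁ = Fin.fromℕ< {0} (<-trans (s≤s z≤n) 2≤n)
      page₂ = Fin.fromℕ< {1} 2≤n

      page₁≢page₂ : page₁ ≢ page₂
      page₁≢page₂ eq = contradiction (Fin.fromℕ<-injective 0 1 _ _ eq) λ ()

    -- With two pages a hub has three distinct neighbours, the other hub and one vertex on each
    -- page. Their images stay distinct, which is too many neighbours for a page vertex.
    hub↦hub : (σ : Automorphism (BookAdj n)) → ∀ b → ∃ λ b′ → to σ (b , Fin.zero) ≡ (b′ , Fin.zero)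
    hub↦hub σ b with to σ (b , Fin.zero) in eq
    ... | b′ , Fin.zero  = b′ , refl
    ... | b′ , Fin.suc i =
      ⊥-elim ([ (λ e → page≢hub (sym (to-injective σ e)))
              , [ (λ e → page₁≢page₂ (Fin.suc-injective (,-injectiveʳ (to-injective σ e))))
                , (λ e → page≢hub (sym (to-injective σ e))) ]′ ]′
        (page-degree (image (other-hub b)) (image (hub b page₁)) (image (hub b page₂))))
      where
      other : Bool → Bool
      other false = true
      other true  = false
      other-hub : ∀ b → BookAdj n (b , Fin.zero) (other b , Fin.zero)
      other-hub false = spine
      other-hub true  = spine'
      image : ∀ {v} → BookAdj n (b , Fin.zero) v → BookAdj n (b′ , Fin.suc i) (to σ v)
      image {v} adj = subst (λ u → BookAdj n u (to σ v)) eq (adj→ σ _ _ adj)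

    injective⇒distinguishing : {C : Set} (f : BookV n → C) → Proper (BookAdj n) f →
      Injective _≡_ _≡_ (pageColors f) → Distinguishing (BookAdj n) f
    injective⇒distinguishing f proper inj σ preserved = fixed
      where
      hub-color : ∀ b b′ → f (b , Fin.zero) ≡ f (b′ , Fin.zero) → b ≡ b′
      hub-color false false _  = refl
      hub-color false true  eq = contradiction eq (proper _ _ spine)
      hub-color true  false eq = contradiction eq (proper _ _ spine')
      hub-color true  true  _  = refl

      fixed-hub : ∀ b → to σ (b , Fin.zero) ≡ (b , Fin.zero)
      -- The image is a hub of the same color, and properness along the spine separates the hub
      -- colors.
      fixed-hub b with b′ , eq ← hub↦hub σ b =
        trans eq (cong (_, Fin.zero) (hub-color b′ b (trans (cong f (sym eq)) (preserved (b , Fin.zero)))))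

      page↦page : ∀ b i → ∃ λ j → to σ (b , Fin.suc i) ≡ (b , Fin.suc j)
      page↦page b i with hub-neighbour (subst (λ u → BookAdj n u (to σ (b , Fin.suc i))) (fixed-hub b) (adj→ σ _ _ (hub b i)))
      ... | inj₂ found     = found
      -- Each hub is already its own image, so injectivity keeps page vertices off the hubs.
      ... | inj₁ (b′ , eq) = ⊥-elim (page≢hub (to-injective σ (trans eq (sym (fixed-hub b′)))))

      rung-page : ∀ {i j} → BookAdj n (false , Fin.suc i) (true , Fin.suc j) → i ≡ j
      rung-page (rung _) = refl

      fixed-page : ∀ i → to σ (false , Fin.suc i) ≡ (false , Fin.suc i) × to σ (true , Fin.suc i) ≡ (true , Fin.suc i)
      fixed-page i
        with j  , eq  ← page↦page false i
           | j′ , eq′ ← page↦page true i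
        -- The image of a rung is an edge, so both ends land on the same page `j`. That page carries
        -- the color pair of page `i`, hence equals it.
        with refl ← rung-page (subst₂ (BookAdj n) eq eq′ (adj→ σ _ _ (rung i)))
        with refl ← inj (cong₂ _,_ (trans (cong f (sym eq)) (preserved (false , Fin.suc i)))
                                   (trans (cong f (sym eq′)) (preserved (true , Fin.suc i))))
        = eq , eq′

      fixed : ∀ v → to σ v ≡ v
      fixed (b     , Fin.zero)  = fixed-hub b
      fixed (false , Fin.suc i) = proj₁ (fixed-page i)
      fixed (true  , Fin.suc i) = proj₂ (fixed-page i)

-- Upper bound for lists

open Counting _≟_
open OffDiagonal _≟_

avoid : ∀ {k} {xs : List ℕ} z → Unique xs → length xs ≡ suc (suc k) → ∃ λ x → x ∈ xs × x ≢ z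
avoid z uniq len with x , x∈xs , x∉[z] ← fresh (z ∷ []) uniq (subst (2 ≤_) (sym len) (s≤s (s≤s z≤n))) =
  x , x∈xs , λ x≡z → x∉[z] (here x≡z)

length-∖-pred : ∀ {m xs} a → Unique xs → length xs ≡ suc m → m ≤ length (xs ∖ a)
length-∖-pred a uniq len = s≤s⁻¹ (≤-trans (≤-reflexive (sym len)) (length-∖-≥ a uniq))

-- For a given page with lists xs and ys, hub colors leaving it more than the
-- guaranteed (k + 1)k pairs: it suffices that xs ∖ a ⊈ ys ∖ b, or that b ∉ ys.
hubColors : ∀ {k H₀ H₁ xs ys} → (∀ {zs} → zs ∈ H₀ ∷ H₁ ∷ xs ∷ ys ∷ [] → Unique zs × length zs ≡ suc (suc k)) →
  ∃₂ λ a b → a ∈ H₀ × b ∈ H₁ × a ≢ b × suc k * k < length (offDiagonal (xs ∖ a) (ys ∖ b))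
hubColors {k} {H₀} {H₁} {xs} {ys} lists
  with u₀ , l₀ ← lists (here refl)
     | u₁ , l₁ ← lists (there (here refl))
     | ux , lx ← lists (there (there (here refl)))
     | uy , ly ← lists (there (there (there (here refl))))
  with ⊆-or-∃∉ xs ys
-- Keeping `a` away from `x` lets `x` survive in the first list while it is missing from the second;
-- `b` only has to differ from `a`.
... | inj₂ (x , x∈xs , x∉ys)
  with a , a∈H₀ , a≢x ← avoid x u₀ l₀
  with b , b∈H₁ , b≢a ← avoid a u₁ l₁ =
  a , b , a∈H₀ , b∈H₁ , b≢a ∘ sym ,
  length-offDiagonal-< (∖-unique ux) (∖-unique uy) (length-∖-pred a ux lx) (length-∖-pred b uy ly)
    (∈-∖⁺ x∈xs (a≢x ∘ sym)) (x∉ys ∘ proj₁ ∘ ∈-∖⁻ ys)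
... | inj₁ xs⊆ys
  -- Any element of `H₀` can be `a`; the avoided value `0` is arbitrary.
  with a , a∈H₀ , _   ← avoid 0 u₀ l₀
  with b , b∈H₁ , b≢a ← avoid a u₁ l₁
  = a , b , a∈H₀ , b∈H₁ , b≢a ∘ sym , enough
  where
  -- Both lists have `k + 2` distinct elements, so `xs ⊆ ys` leaves no room in `ys` for an element
  -- outside `xs`.
  b∉xs⇒b∉ys : b ∉ xs → b ∉ ys
  b∉xs⇒b∉ys b∉xs b∈ys = <⇒≱ (length-∖-< b∈ys)
    (subst (_≤ length (ys ∖ b)) (trans lx (sym ly))
      (length-⊆ ux λ z∈xs → ∈-∖⁺ (xs⊆ys z∈xs) λ z≡b → b∉xs (subst (_∈ xs) z≡b z∈xs)))

  enough : suc k * k < length (offDiagonal (xs ∖ a) (ys ∖ b))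
  enough with b ∈? xs
  -- Since `b` differs from `a`, it survives in the first list but is deleted from the second.
  ... | yes b∈xs = length-offDiagonal-< (∖-unique ux) (∖-unique uy)
    (length-∖-pred a ux lx) (length-∖-pred b uy ly)
    (∈-∖⁺ b∈xs b≢a) λ b∈ → proj₂ (∈-∖⁻ ys b∈) refl
  -- Removing `b` costs `ys` nothing: it keeps `k + 2` elements, which gives `suc k * suc k` pairs.
  ... | no  b∉xs = <-≤-trans (*-monoʳ-< (suc k) (n<1+n k))
    (length-offDiagonal (∖-unique ux) (∖-unique uy) (length-∖-pred a ux lx)
      (subst (_≤ length (ys ∖ b)) ly (length-∖-∉ uy (b∉xs⇒b∉ys b∉xs))))

listColorable : ∀ {n k} → 2 ≤ n → n ≤ suc (suc k * k) → ProperDistListK (BookAdj n) (suc (suc k))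
listColorable {suc n} {k} 2≤n n≤ (L , ok)
  -- The hub colors favour the page of index 0 because `greedy` serves that page last.
  with a , b , a∈ , b∈ , a≢b , many ←
    hubColors {H₀ = L (false , Fin.zero)} {L (true , Fin.zero)}
      {L (false , Fin.suc Fin.zero)} {L (true , Fin.suc Fin.zero)}
      (λ { (here refl) → ok _
         ; (there (here refl)) → ok _
         ; (there (there (here refl))) → ok _
         ; (there (there (there (here refl)))) → ok _ })
  = f , f∈L , proper , injective⇒distinguishing 2≤n f proper (proj₂ (proj₂ chosen))
  where
  X Y : Fin (suc n) → List ℕ
  X i = L (false , Fin.suc i) ∖ a
  Y i = L (true  , Fin.suc i) ∖ b

  X-unique : ∀ i → Unique (X i)
  X-unique i = ∖-unique (proj₁ (ok _))
  Y-unique : ∀ i → Unique (Y i)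
  Y-unique i = ∖-unique (proj₁ (ok _))

  large : ∀ i → suc n ≤ length (offDiagonal (X i) (Y i)) + toℕ i
  large Fin.zero    = subst (suc n ≤_) (sym (+-identityʳ _)) (≤-trans n≤ many)
  -- These pages are only sure of `suc k * k` pairs; the missing one is supplied by `toℕ j`, which
  -- is at least one.
  large (Fin.suc i) = begin
    suc n                                                       ≤⟨ n≤ ⟩
    suc (suc k * k)                                             ≤⟨ s≤s (length-offDiagonal (X-unique j) (Y-unique j)
                                                                     (length-∖-pred a (proj₁ (ok _)) (proj₂ (ok _)))
                                                                     (length-∖-pred b (proj₁ (ok _)) (proj₂ (ok _)))) ⟩
    suc (length (offDiagonal (X j) (Y j)))                      ≤⟨ s≤s (m≤m+n _ (toℕ i)) ⟩
    suc (length (offDiagonal (X j) (Y j)) + toℕ i)              ≡⟨ +-suc _ (toℕ i) ⟨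
    length (offDiagonal (X j) (Y j)) + toℕ j                    ∎
    where
    open ≤-Reasoning
    j = Fin.suc i

  chosen = Counting.greedy (≡-dec _≟_ _≟_) (suc n) (λ i → offDiagonal (X i) (Y i))
    (λ i → offDiagonal-unique (X-unique i) (Y-unique i)) large

  g = proj₁ chosen

  f : BookV (suc n) → ℕ
  f (false , Fin.zero)  = a
  f (true  , Fin.zero)  = b
  f (false , Fin.suc i) = proj₁ (g i)
  f (true  , Fin.suc i) = proj₂ (g i)

  admissible : ∀ i → proj₁ (g i) ∈ X i × proj₂ (g i) ∈ Y i × proj₁ (g i) ≢ proj₂ (g i)
  admissible i = ∈-offDiagonal⁻ (X i) (Y i) (proj₁ (proj₂ chosen) i)

  x∈ : ∀ i → proj₁ (g i) ∈ L (false , Fin.suc i) × proj₁ (g i) ≢ a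
  x∈ i = ∈-∖⁻ (L (false , Fin.suc i)) (proj₁ (admissible i))
  y∈ : ∀ i → proj₂ (g i) ∈ L (true , Fin.suc i) × proj₂ (g i) ≢ b
  y∈ i = ∈-∖⁻ (L (true , Fin.suc i)) (proj₁ (proj₂ (admissible i)))

  f∈L : ∀ v → f v ∈ L v
  f∈L (false , Fin.zero)  = a∈
  f∈L (true  , Fin.zero)  = b∈
  f∈L (false , Fin.suc i) = proj₁ (x∈ i)
  f∈L (true  , Fin.suc i) = proj₁ (y∈ i)

  proper : Proper (BookAdj (suc n)) f
  proper _ _ spine           = a≢b
  proper _ _ spine'          = a≢b ∘ sym
  proper _ _ (hub false i)   = proj₂ (x∈ i) ∘ sym
  proper _ _ (hub true i)    = proj₂ (y∈ i) ∘ sym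
  proper _ _ (hub' false i)  = proj₂ (x∈ i)
  proper _ _ (hub' true i)   = proj₂ (y∈ i)
  proper _ _ (rung i)        = proj₂ (proj₂ (admissible i))
  proper _ _ (rung' i)       = proj₂ (proj₂ (admissible i)) ∘ sym

-- Lower bound

-- Giving every vertex the same list, the numbers below `r`, turns a list coloring into an ordinary
-- one.
listColorable⇒colorable : ∀ {V : Set} {Adj : V → V → Set} {r} → ProperDistListK Adj r → ProperDistR Adj r
listColorable⇒colorable {V} {Adj} {r} all-lists = g , g-proper , g-dist
  where
  colors : List ℕ
  colors = map toℕ (allFin r)

  solution = all-lists ((λ _ → colors) , λ _ →
    Unique.map⁺ Fin.toℕ-injective (Unique.allFin⁺ r) ,
    trans (length-map toℕ (allFin r)) (length-tabulate id))

  f      = proj₁ solution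
  f∈     = proj₁ (proj₂ solution)
  proper = proj₁ (proj₂ (proj₂ solution))
  dist   = proj₂ (proj₂ (proj₂ solution))

  g : V → Fin r
  g v = proj₁ (∈-map⁻ toℕ (f∈ v))

  toℕ-g : ∀ v → f v ≡ toℕ (g v)
  toℕ-g v = proj₂ (proj₂ (∈-map⁻ toℕ (f∈ v)))

  -- Both properness and distinguishing pass from `f` to `g` through this direction.
  g⇒f : ∀ {u v} → g u ≡ g v → f u ≡ f v
  g⇒f {u} {v} eq = trans (toℕ-g u) (trans (cong toℕ eq) (sym (toℕ-g v)))

  g-proper : Proper Adj g
  g-proper u v adj eq = proper u v adj (g⇒f eq)

  g-dist : Distinguishing Adj g
  g-dist σ preserved = dist σ (g⇒f ∘ preserved)

-- The pairs (x , x) with x ∉ {a , b} are also in ({a}ᶜ × {b}ᶜ), and no page carries one.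
colorable⇒≤ : ∀ {n k} → ProperDistR (BookAdj n) (suc (suc k)) → n ≤ suc (suc k * k)
colorable⇒≤ {n} {k} (f , proper , dist) = +-cancelʳ-≤ k n (suc (suc k * k)) (begin
  n + k                                                ≤⟨ +-monoʳ-≤ n X∖b-large ⟩
  n + length (X C.∖ b)                                 ≡⟨ cong₂ _+_ (length-tabulate (pageColors f)) (length-map _ (X C.∖ b)) ⟨
  length pages + length (O.diagonal (X C.∖ b))         ≡⟨ length-++ pages ⟨
  length (pages ++ O.diagonal (X C.∖ b))               ≤⟨ Counting.length-⊆ (≡-dec Fin._≟_ Fin._≟_) uniq inside ⟩
  length (cartesianProduct X Y)                        ≡⟨ length-cartesianProduct X Y ⟩
  length X * length Y                                  ≤⟨ *-mono-≤ (small a) (small b) ⟩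
  -- The square exceeds the target by exactly `k`, the guaranteed number of diagonal pairs, so `k`
  -- cancels.
  suc k * suc k                                        ≡⟨ *-suc (suc k) k ⟩
  suc k + suc k * k                                    ≡⟨ cong suc (+-comm k (suc k * k)) ⟩
  suc (suc k * k) + k                                  ∎)
  where
  open ≤-Reasoning
  module C = Counting (Fin._≟_ {suc (suc k)})
  module O = OffDiagonal (Fin._≟_ {suc (suc k)})

  a = f (false , Fin.zero)
  b = f (true , Fin.zero)

  all = allFin (suc (suc k))
  X = all C.∖ a
  Y = all C.∖ b
  pages = tabulate (pageColors f)

  all-unique : Unique all
  all-unique = Unique.allFin⁺ _

  length-all : length all ≡ suc (suc k)
  length-all = length-tabulate id

  small : ∀ c → length (all C.∖ c) ≤ suc k
  small c = s≤s⁻¹ (subst (length (all C.∖ c) <_) length-all (C.length-∖-< (∈-allFin c)))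

  X∖b-large : k ≤ length (X C.∖ b)
  -- Each of the two removals costs at most one of the `k + 2` colors.
  X∖b-large = s≤s⁻¹ (s≤s⁻¹ (≤-trans (≤-reflexive (sym length-all))
    (≤-trans (C.length-∖-≥ a all-unique) (s≤s (C.length-∖-≥ b (C.∖-unique {a} all-unique))))))

  uniq : Unique (pages ++ O.diagonal (X C.∖ b))
  uniq = Unique.++⁺ (Unique.tabulate⁺ (distinguishing⇒injective f dist))
    (Unique.map⁺ ,-injectiveˡ (C.∖-unique {b} (C.∖-unique {a} all-unique)))
    λ { (p∈pages , p∈diag) → disjoint (∈-tabulate⁻ p∈pages) (∈-map⁻ _ p∈diag) }
    where
    disjoint : ∀ {p} → (∃ λ i → p ≡ pageColors f i) → (∃ λ x → x ∈ X C.∖ b × p ≡ (x , x)) → ⊥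
    disjoint (i , refl) (x , _ , eq) =
      proper _ _ (rung i) (trans (,-injectiveˡ eq) (sym (,-injectiveʳ eq)))

  inside : pages ++ O.diagonal (X C.∖ b) ⊆ cartesianProduct X Y
  inside p∈ with ∈-++⁻ pages p∈
  ... | inj₁ p∈pages with i , refl ← ∈-tabulate⁻ p∈pages =
    ∈-cartesianProduct⁺ (C.∈-∖⁺ (∈-allFin _) (proper _ _ (hub' false i)))
                        (C.∈-∖⁺ (∈-allFin _) (proper _ _ (hub' true i)))
  ... | inj₂ p∈diag with x , x∈ , refl ← ∈-map⁻ _ p∈diag
    with x∈X , x≢b ← C.∈-∖⁻ X x∈ = ∈-cartesianProduct⁺ x∈X (C.∈-∖⁺ (∈-allFin x) x≢b)

-- The common value of both parameters

colorable⇒2≤ : ∀ {n r} → ProperDistR (BookAdj n) r → ∃ λ k → r ≡ suc (suc k)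
colorable⇒2≤ {r = zero}        (f , _) = ⊥-elim (Fin.¬Fin0 (f (false , Fin.zero)))
colorable⇒2≤ {r = suc zero}    (f , proper , _)
  with f (false , Fin.zero) | f (true , Fin.zero) | proper _ _ spine
... | Fin.zero | Fin.zero | 0≢0 = contradiction refl 0≢0
colorable⇒2≤ {r = suc (suc k)} _       = k , refl

theorem5p11 : (n : ℕ) → 2 ≤ n →
    ∃ (λ m → χD≡ (BookAdj n) m × χDL≡ (BookAdj n) m)
theorem5p11 n 2≤n
  -- The value `n` itself satisfies the bound, so a least `k` exists.
  with k , n≤ , minimal ← least (λ k → n ≤? suc (suc k * k)) n
         (≤-trans (m≤m+n n (n * n)) (n≤1+n _))
  = suc (suc k) ,
    -- Constant lists carry the upper bound from lists to ordinary colorings, and the lower bound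
    -- from ordinary colorings to lists.
    (listColorable⇒colorable colorable , none) ,
    (colorable , λ r r< → none r r< ∘ listColorable⇒colorable)
  where
  colorable : ProperDistListK (BookAdj n) (suc (suc k))
  colorable = listColorable 2≤n n≤

  none : ∀ r → r < suc (suc k) → ¬ ProperDistR (BookAdj n) r
  none r r< col with j , refl ← colorable⇒2≤ col =
    -- Success with `j + 2` colors would make `j < k` satisfy the bound, against the choice of `k`.
    minimal j (s≤s⁻¹ (s≤s⁻¹ r<)) (colorable⇒≤ col)
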